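{- Let $n\geqslant 3$ and $k=n/2$. For a vertex $\pi$ of $P_n$ with $\pi_1=i$ and $\pi_n=j$ (so $i\neq j$), define $$f(\pi)=\begin{cases} i-j, & i>j,\\ n+i-j, & i<j,\end{cases}$$ and $$c(\pi)=f(\pi)+\varepsilon(\pi),$$ where $$\varepsilon(\pi)=\begin{cases} +1, & j>k \text{ and } f(\pi)=k,\\ -1, & j>k \text{ and } f(\pi)=k+1,\\ 0, & \text{otherwise}.\end{cases}$$ (For $n$ odd, $\varepsilon\equiv 0$.) Then $c$ is a proper vertex coloring of $P_n$ with values in $\{1,\ldots,n-1\}$. Moreover, it is equitable: each of the $n-1$ color classes has exactly $n\,(n-2)!$ vertices.
   Context: For $n\geqslant 1$, the Pancake graph $P_n$ is the Cayley graph on the symmetric group $\mathrm{Sym}_n$, with permutations written in one-line notation $\pi=[\pi_1\pi_2\ldots\pi_n]$. Its generating set consists of the prefix-reversals $r_i$, $2\leqslant i\leqslant n$. Multiplying $\pi$ on the right by $r_i$ reverses the first $i$ entries: $\pi r_i=[\pi_i\pi_{i-1}\ldots\pi_1\pi_{i+1}\ldots\pi_n]$. Two vertices $\pi,\sigma$ are adjacent iff $\sigma=\pi r_i$ for some $2\leqslant i\leqslant n$. A proper coloring is equitable if the sizes of any two color classes differ by at most one. -}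

module Defs where

open import Algebra.Bundles using (Group)
open import Data.Bool.Base using (if_then_else_)
open import Data.Fin.Base using (Fin; zero; fromℕ; fromℕ<; inject≤; opposite; toℕ)
open import Data.Fin.Permutation as Perm
  using (Permutation′; permutation; _⟨$⟩ʳ_; _⟨$⟩ˡ_; _∘ₚ_; flip; inverseˡ; inverseʳ)
open import Data.Fin.Properties
  using (toℕ-injective; toℕ-inject≤; toℕ<n; toℕ-fromℕ<; opposite-involutive)
open import Data.Integer.Base as ℤ using (ℤ; +_; 0ℤ; 1ℤ; -1ℤ)
open import Data.Nat.Base using (ℕ; suc; _≤_; _<_; ∣_-_∣; NonZero)
import Data.Nat.Properties as ℕ
open import Data.Product.Base using (Σ; ∃; ∃₂; _×_; _,_; proj₁)
open import Data.Rational.Unnormalised.Base as ℚᵘ using (ℚᵘ; 1ℚᵘ; _/_)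
open import Data.Rational.Unnormalised.Properties using (_≃?_; _<?_)
open import Function.Bundles using (Inverse)
open import Level using (0ℓ)
open import Relation.Binary.Bundles using (Setoid)
open import Relation.Binary.Core using (Rel)
import Relation.Binary.Construct.On as On
open import Relation.Binary.PropositionalEquality
  using (_≡_; refl; sym; trans; cong; setoid)
open import Relation.Nullary using (Dec; yes; no; contradiction; ¬_)
open import Relation.Nullary.Decidable using (⌊_⌋; _×-dec_)
open import Relation.Unary using (Pred)

-- Permutations compare pointwise, and (π · ρ) maps x to π (ρ x), so that
-- right multiplication acts on the positions of the one-line notation.
-- The library's π ∘ₚ ρ composes in the opposite order.
Sym : ℕ → Group 0ℓ 0ℓ
Sym n = record
  { Carrier = Permutation′ n
  ; _≈_     = Perm._≈_
  ; _∙_     = λ π ρ → ρ ∘ₚ π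
  ; ε       = Perm.id
  ; _⁻¹     = flip
  ; isGroup = record
    { isMonoid = record
      { isSemigroup = record
        { isMagma = record
          { isEquivalence = record
            { refl  = λ _ → refl
            ; sym   = λ p i → sym (p i)
            ; trans = λ p q i → trans (p i) (q i)
            }
          ; ∙-cong = λ {π} {π′} {ρ} {ρ′} p q i →
              trans (p (ρ ⟨$⟩ʳ i)) (cong (π′ ⟨$⟩ʳ_) (q i))
          }
        ; assoc = λ _ _ _ _ → refl
        }
      ; identity = (λ _ _ → refl) , (λ _ _ → refl)
      }
    ; inverse = (λ π _ → inverseˡ π) , (λ π _ → inverseʳ π)
    ; ⁻¹-cong = λ {π} {ρ} p i →
        trans (sym (inverseˡ ρ))
          (cong (ρ ⟨$⟩ˡ_)
            (trans (sym (p (π ⟨$⟩ˡ i))) (inverseʳ π)))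
    }
  }

record Graph : Set₁ where
  field
    vertices : Setoid 0ℓ 0ℓ
  open Setoid vertices public renaming (Carrier to Vertex)
  field
    _~_ : Rel Vertex 0ℓ

CayleyGraph : (G : Group 0ℓ 0ℓ) → Pred (Group.Carrier G) 0ℓ → Graph
CayleyGraph G S = record
  { vertices = setoid′
  ; _~_      = λ g h → ∃ λ s → S s × h ≈ (g ∙ s)
  }
  where open Group G renaming (setoid to setoid′)

reverseAt : ∀ {i n} → .(i ≤ n) → (x : Fin n) → Dec (toℕ x < i) → Fin n
reverseAt i≤n x (yes x<i) = inject≤ (opposite (fromℕ< x<i)) i≤n
reverseAt i≤n x (no  _)   = x

reverseFirst : ∀ {n} (i : ℕ) → .(i ≤ n) → Fin n → Fin n
reverseFirst i i≤n x = reverseAt i≤n x (toℕ x ℕ.<? i)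

reverseFirst-involutive : ∀ {n} i .(i≤n : i ≤ n) x →
  reverseFirst i i≤n (reverseFirst i i≤n x) ≡ x
reverseFirst-involutive {n} i i≤n x with toℕ x ℕ.<? i
... | no x≮i = lemma (toℕ x ℕ.<? i)
  where
  lemma : ∀ d → reverseAt i≤n x d ≡ x
  lemma (yes x<i) = contradiction x<i x≮i
  lemma (no  _)   = refl
... | yes x<i = lemma (toℕ y ℕ.<? i)
  where
  x′ : Fin i
  x′ = fromℕ< x<i

  y : Fin n
  y = inject≤ (opposite x′) i≤n

  toℕ-y : toℕ y ≡ toℕ (opposite x′)
  toℕ-y = toℕ-inject≤ (opposite x′) i≤n

  fromℕ<-y : (y<i : toℕ y < i) → fromℕ< y<i ≡ opposite x′
  fromℕ<-y y<i = toℕ-injective (trans (toℕ-fromℕ< y<i) toℕ-y)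

  lemma : ∀ d → reverseAt i≤n y d ≡ x
  lemma (no y≮i) = contradiction
    (ℕ.≤-trans (ℕ.≤-reflexive (cong suc toℕ-y)) (toℕ<n (opposite x′))) y≮i
  lemma (yes y<i) = toℕ-injective
    (trans (toℕ-inject≤ (opposite (fromℕ< y<i)) i≤n)
      (trans (cong toℕ (trans (cong opposite (fromℕ<-y y<i)) (opposite-involutive x′)))
        (toℕ-fromℕ< x<i)))

prefixReversal : ∀ {n} (i : ℕ) → .(i ≤ n) → Permutation′ n
prefixReversal i i≤n = permutation (reverseFirst i i≤n) (reverseFirst i i≤n)
  (reverseFirst-involutive i i≤n) (reverseFirst-involutive i i≤n)

IsPrefixReversal : ∀ {n} → Pred (Permutation′ n) 0ℓ
IsPrefixReversal {n} ρ =
  ∃ λ i → 2 ≤ i × Σ (i ≤ n) λ i≤n → ρ Perm.≈ prefixReversal i i≤n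

Pancake : ℕ → Graph
Pancake n = CayleyGraph (Sym n) IsPrefixReversal

HasSize : Setoid 0ℓ 0ℓ → ℕ → Set
HasSize S m = Inverse (setoid (Fin m)) S

module _ (G : Graph) where
  open Graph G

  record IsProperColoring (Color : Pred ℤ 0ℓ) (c : Vertex → ℤ) : Set where
    field
      respects : ∀ {u v} → u ≈ v → c u ≡ c v
      inRange  : ∀ v → Color (c v)
      proper   : ∀ {u v} → u ~ v → ¬ c u ≡ c v

  ColorClass : (Vertex → ℤ) → ℤ → Setoid 0ℓ 0ℓ
  ColorClass c a = On.setoid vertices (proj₁ {B = λ v → c v ≡ a})

  IsEquitable : Pred ℤ 0ℓ → (Vertex → ℤ) → Set
  IsEquitable Color c = ∀ {a b} → Color a → Color b →
    ∃₂ λ s t → HasSize (ColorClass c a) s × HasSize (ColorClass c b) t × ∣ s - t ∣ ≤ 1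

-- Positions and entries are elements of Fin n, hence 0-based;
-- entries are shifted to 1, …, n.
entry : ∀ {n} → Permutation′ n → Fin n → ℕ
entry π p = suc (toℕ (π ⟨$⟩ʳ p))

firstPos : ∀ {n} → .{{NonZero n}} → Fin n
firstPos {suc n} = zero

lastPos : ∀ {n} → .{{NonZero n}} → Fin n
lastPos {suc n} = fromℕ n

module _ {n : ℕ} .{{_ : NonZero n}} where

  firstEntry lastEntry : Permutation′ n → ℕ
  firstEntry π = entry π firstPos
  lastEntry  π = entry π lastPos

  -- The second branch is meant for firstEntry π < lastEntry π: the two
  -- entries are distinct as soon as n ≥ 2.
  f : Permutation′ n → ℤ
  f π = if ⌊ j ℕ.<? i ⌋ then + i ℤ.- + j else + n ℤ.+ + i ℤ.- + j
    where
    i j : ℕ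
    i = firstEntry π
    j = lastEntry π

  ε : Permutation′ n → ℤ
  ε π =
    if ⌊ (k <? j) ×-dec (f π / 1 ≃? k) ⌋ then 1ℤ
    else if ⌊ (k <? j) ×-dec (f π / 1 ≃? k ℚᵘ.+ 1ℚᵘ) ⌋ then -1ℤ
    else 0ℤ
    where
    k j : ℚᵘ
    k = + n / 2
    j = + lastEntry π / 1

  c : Permutation′ n → ℤ
  c π = f π ℤ.+ ε π

Color : ℕ → Pred ℤ 0ℓ
Color n a = 1ℤ ℤ.≤ a × a ℤ.≤ + n ℤ.- 1ℤ

{-# OPTIONS --safe #-}
module Submission where

-- The colour a of π depends only on the first entry i and the last entry j.
-- For fixed j, the cyclic difference i − j takes every value 1, …, n − 1 once,
-- and ε only exchanges the middle values k and k + 1 when j > k; so for fixed j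
-- the colour determines i, and every colour occurs. Reversing a proper prefix
-- fixes j and changes i, hence the colour. Reversing everything exchanges i and
-- j and turns a difference d into n − d, so two equal colours could only come
-- from d = k; but then exactly one of i, j exceeds k and ε separates them.
-- For each colour class, j is free, i is determined by j, and the remaining
-- n − 2 entries are arbitrary.

open import Defs
open import Algebra.Bundles using (Group)
open import Data.Bool.Base using (if_then_else_)
open import Data.Fin.Base as Fin using (Fin; zero; suc; fromℕ; fromℕ<; inject≤; opposite; toℕ; punchIn; punchOut)
open import Data.Fin.Permutation as Perm
  using (Permutation; Permutation′; _⟨$⟩ʳ_; insert; remove; insert-remove; remove-insert; insert-punchIn; punchIn-permute)
import Data.Fin.Properties as Fin
open import Data.Integer.Base as ℤ using (0ℤ; 1ℤ; -1ℤ) renaming (+_ to pos)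
import Data.Integer.Properties as ℤ
open import Algebra.Properties.AbelianGroup ℤ.+-0-abelianGroup using (identityʳ-unique)
open import Data.Nat.Base using (ℕ; zero; suc; _≥_; _+_; _*_; _∸_; _!; _≤_; _<_; NonZero; s≤s; z≤n; s≤s⁻¹)
open import Data.Nat.Divisibility using (_∣_; divides)
open import Data.Nat.Properties
open import Data.Product.Base using (∃; ∃₂; _×_; _,_; proj₁; proj₂)
open import Data.Product.Function.NonDependent.Setoid using (_×-inverse_)
open import Data.Product.Relation.Binary.Pointwise.NonDependent using (_×ₛ_; Pointwise-≡↔≡)
open import Data.Rational.Unnormalised.Base as ℚᵘ using (1ℚᵘ; _/_)
import Data.Rational.Unnormalised.Properties as ℚᵘ
open import Data.Sum.Base using (_⊎_; inj₁; inj₂)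
open import Function.Base using (_∘_)
open import Function.Bundles using (Inverse; Injection)
import Function.Construct.Composition as Composition
import Function.Construct.Identity as Identity
import Function.Construct.Symmetry as Symmetry
open import Function.Properties.Inverse using (↔⇒↣)
open import Level using (0ℓ)
open import Relation.Binary.Bundles using (Setoid)
open import Relation.Binary.PropositionalEquality
  using (_≡_; _≢_; refl; sym; trans; cong; subst; subst₂; setoid; module ≡-Reasoning)
open import Relation.Nullary using (¬_; Dec; yes; no; contradiction)
open import Relation.Nullary.Decidable using (⌊_⌋; _×-dec_)

-- Cyclic differences

private
  variable
    n i i′ j d d′ a b : ℕ

infix 4 _∈[1,_]
_∈[1,_] : ℕ → ℕ → Set
i ∈[1, n ] = 1 ≤ i × i ≤ n

-- The residue of i - j modulo n, in additive form: sums can be cancelled, and truncated subtraction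
-- stays out of the case analysis.
data Difference (n i j d : ℕ) : Set where
  above : j < i → d + j ≡ i     → Difference n i j d
  below : i < j → d + j ≡ n + i → Difference n i j d

difference-range : i ∈[1, n ] → j ∈[1, n ] → Difference n i j d → 1 ≤ d × d < n
difference-range {d = zero} _ _ (above j<i j≡i) = contradiction j≡i (<⇒≢ j<i)
difference-range {d = suc d} (_ , i≤n) (1≤j , _) (above _ refl) =
  s≤s z≤n , <-≤-trans (m<m+n (suc d) 1≤j) i≤n
difference-range {n = n} {d = zero} (1≤i , _) (_ , j≤n) (below _ j≡n+i) =
  contradiction j≤n (<⇒≱ (<-≤-trans (m<m+n n 1≤i) (≤-reflexive (sym j≡n+i))))
difference-range {n = n} {j = j} {d = suc d} _ _ (below i<j eq) =
  s≤s z≤n , +-cancelʳ-< j (suc d) n (≤-<-trans (≤-reflexive eq) (+-monoʳ-< n i<j))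

difference-functional : Difference n i j d → Difference n i j d′ → d ≡ d′
difference-functional {j = j} {d = d} {d′} (above _ p) (above _ q) =
  +-cancelʳ-≡ j d d′ (trans p (sym q))
difference-functional {j = j} {d = d} {d′} (below _ p) (below _ q) =
  +-cancelʳ-≡ j d d′ (trans p (sym q))
difference-functional (above j<i _) (below i<j _) = contradiction j<i (<-asym i<j)
difference-functional (below i<j _) (above j<i _) = contradiction j<i (<-asym i<j)

private
  n+i≢i′ : 1 ≤ i → i′ ≤ n → n + i ≢ i′
  n+i≢i′ {n = n} 1≤i i′≤n refl = contradiction i′≤n (<⇒≱ (m<m+n n 1≤i))

-- Both first entries are congruent to d + j modulo n. If only one of them wraps around, the other
-- would exceed n.
difference-injective : i ∈[1, n ] → i′ ∈[1, n ] →
  Difference n i j d → Difference n i′ j d → i ≡ i′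
difference-injective _ _ (above _ p) (above _ q) = trans (sym p) q
difference-injective {n = n} _ _ (below _ p) (below _ q) = +-cancelˡ-≡ n _ _ (trans (sym p) q)
difference-injective (_ , i≤n) (1≤i′ , _) (above _ p) (below _ q) =
  contradiction (trans (sym q) p) (n+i≢i′ 1≤i′ i≤n)
difference-injective (1≤i , _) (_ , i′≤n) (below _ p) (above _ q) =
  contradiction (trans (sym p) q) (n+i≢i′ 1≤i i′≤n)

-- The entry is d + j, reduced by n when it exceeds n.
difference-surjective : 1 ≤ d → d < n → j ∈[1, n ] → ∃ λ i → i ∈[1, n ] × Difference n i j d
difference-surjective {d} {n} {j} 1≤d d<n (1≤j , j≤n) with d + j ≤? n
... | yes d+j≤n = d + j , (≤-trans 1≤d (m≤m+n d j) , d+j≤n) , above (m<n+m j 1≤d) refl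
... | no  d+j≰n = i₀ , (m<n⇒0<n∸m n<d+j , ≤-trans (<⇒≤ i₀<j) j≤n) , below i₀<j (sym n+i₀≡d+j)
  where
  i₀ : ℕ
  i₀ = d + j ∸ n

  n<d+j : n < d + j
  n<d+j = ≰⇒> d+j≰n

  n+i₀≡d+j : n + i₀ ≡ d + j
  n+i₀≡d+j = m+[n∸m]≡n (<⇒≤ n<d+j)

  i₀<j : i₀ < j
  i₀<j = +-cancelˡ-< n i₀ j (≤-<-trans (≤-reflexive n+i₀≡d+j) (+-monoˡ-< j d<n))

difference-irrefl : Difference n i j d → i ≢ j
difference-irrefl (above j<i _) refl = <-irrefl refl j<i
difference-irrefl (below i<j _) refl = <-irrefl refl i<j

-- The disjunction records which order does not wrap around: there the larger entry exceeds the
-- smaller by the difference itself. This later locates the entries on either side of k.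
data Opposite (n i j d d′ : ℕ) : Set where
  opposites : d + d′ ≡ n → d + j ≡ i ⊎ d′ + i ≡ j → Opposite n i j d d′

difference-reverse : Difference n i j d → Difference n j i d′ → Opposite n i j d d′
difference-reverse {n} {j = j} {d = d} {d′} (above _ refl) (below _ q) = opposites
  (+-cancelʳ-≡ j (d + d′) n (begin
    d + d′ + j    ≡⟨ cong (_+ j) (+-comm d d′) ⟩
    d′ + d + j    ≡⟨ +-assoc d′ d j ⟩
    d′ + (d + j)  ≡⟨ q ⟩
    n + j         ∎)) (inj₁ refl)
  where open ≡-Reasoning
difference-reverse {n} {i = i} {d = d} {d′} (below _ p) (above _ refl) = opposites
  (+-cancelʳ-≡ i (d + d′) n (trans (+-assoc d d′ i) p)) (inj₂ refl)
difference-reverse (above j<i _) (above i<j _) = contradiction j<i (<-asym i<j)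
difference-reverse (below i<j _) (below j<i _) = contradiction j<i (<-asym i<j)

-- The exchange of the two middle colours

-- Doubling avoids halving n: n < j + j says j > k, d + d ≡ n says d = k,
-- and d + d ≡ 2 + n says d = k + 1.
data Swap (n j : ℕ) : ℕ → ℕ → Set where
  raise : n < j + j → d + d ≡ n → Swap n j d (suc d)
  lower : n < j + j → d + d ≡ n → Swap n j (suc d) d
  keep  : (n < j + j → d + d ≢ n) → (n < j + j → d + d ≢ 2 + n) → Swap n j d d

private
  n*2≡n+n : ∀ n → n * 2 ≡ n + n
  n*2≡n+n n = trans (*-comm n 2) (cong (n +_) (+-identityʳ n))

  double-suc : ∀ d → suc d + suc d ≡ 2 + (d + d)
  double-suc d = cong suc (+-suc d d)

  half : d + d ≡ n → d + d′ ≡ n → d′ ≡ d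
  half {d} {d′ = d′} d+d≡n d+d′≡n = +-cancelˡ-≡ d d′ d (trans d+d′≡n (sym d+d≡n))

  double-injective : d + d ≡ d′ + d′ → d ≡ d′
  double-injective {zero}  {zero}   _  = refl
  double-injective {suc d} {suc d′} eq = cong suc (double-injective
    (+-cancelˡ-≡ 2 _ _ (trans (sym (double-suc d)) (trans eq (double-suc d′)))))

-- The exchange is an involution, so its inverse needs no lemmas of its own: functionality also
-- yields injectivity.
swap-sym : Swap n j d a → Swap n j a d
swap-sym (raise p q) = lower p q
swap-sym (lower p q) = raise p q
swap-sym (keep p q)  = keep p q

swap-functional : Swap n j d a → Swap n j d b → a ≡ b
swap-functional (raise _ _) (raise _ _) = refl
swap-functional (raise _ q) (lower _ q′) = contradiction (double-injective (trans q (sym q′))) 1+n≢n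
swap-functional (raise p q) (keep p′ _) = contradiction q (p′ p)
swap-functional (lower _ q) (raise _ q′) = contradiction (double-injective (trans q′ (sym q))) 1+n≢n
swap-functional (lower _ _) (lower _ _) = refl
swap-functional (lower {d} p q) (keep _ p′) =
  contradiction (trans (double-suc d) (cong (2 +_) q)) (p′ p)
swap-functional (keep p′ _) (raise p q) = contradiction q (p′ p)
swap-functional (keep _ p′) (lower {d} p q) =
  contradiction (trans (double-suc d) (cong (2 +_) q)) (p′ p)
swap-functional (keep _ _) (keep _ _) = refl

-- Raising k stays in range because k + 1 < 2k = n once k is at least 2; n = 2 would fail here.
-- Lowering to 0 would make n zero.
swap-range : 3 ≤ n → Swap n j d a → 1 ≤ d × d < n → 1 ≤ a × a < n
swap-range 3≤n (raise {d} _ refl) (1≤d , d<n) = s≤s z≤n , 1+d<d+d d 3≤n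
  where
  1+d<d+d : ∀ d → 3 ≤ d + d → suc d < d + d
  1+d<d+d (suc zero)      (s≤s (s≤s ()))
  1+d<d+d (suc (suc d)) _ = s≤s (s≤s (m≤n+m (2 + d) d))
swap-range 3≤n (lower {zero} _ refl) _ = contradiction 3≤n λ()
swap-range 3≤n (lower {suc d} _ _) (_ , d<n) = s≤s z≤n , <⇒≤ d<n
swap-range 3≤n (keep _ _) range = range

swap-odd : ¬ 2 ∣ n → Swap n j d a → d ≡ a
swap-odd odd (keep _ _) = refl
swap-odd odd (raise {d} _ d+d≡n) =
  contradiction (divides d (trans (sym d+d≡n) (sym (n*2≡n+n d)))) odd
swap-odd odd (lower {d} _ d+d≡n) =
  contradiction (divides d (trans (sym d+d≡n) (sym (n*2≡n+n d)))) odd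

private
  -- Here d = k and i = k + j: then i > k because j is positive, and j ≤ k because i ≤ 2k.
  middle : 1 ≤ j → i ≤ n → d + j ≡ i → d + d ≡ n → n < i + i × ¬ n < j + j
  middle {j} {d = d} 1≤j d+j≤n refl refl = +-mono-< d<d+j d<d+j , ≤⇒≯ (+-mono-≤ j≤d j≤d)
    where
    d<d+j : d < d + j
    d<d+j = m<m+n d 1≤j

    j≤d : j ≤ d
    j≤d = +-cancelˡ-≤ d j d d+j≤n

  -- A difference k arises only between entries on different sides of k.
  middle-split : i ∈[1, n ] → j ∈[1, n ] → d + j ≡ i ⊎ d + i ≡ j → d + d ≡ n →
    ¬ (n < i + i × n < j + j) × (n < i + i ⊎ n < j + j)
  middle-split (_ , i≤n) (1≤j , _) (inj₁ d+j≡i) d+d≡n =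
    let high , low = middle 1≤j i≤n d+j≡i d+d≡n in low ∘ proj₂ , inj₁ high
  middle-split (1≤i , _) (_ , j≤n) (inj₂ d+i≡j) d+d≡n =
    let high , low = middle 1≤i j≤n d+i≡j d+d≡n in low ∘ proj₁ , inj₂ high

-- Two raises would need both ends above k, and two keeps force d = d′ = k with neither end above k;
-- `middle-split` excludes both. The other cases fail by arithmetic with d + d′ = n and 2k = n.
swap-opposite : i ∈[1, n ] → j ∈[1, n ] → Opposite n i j d d′ →
  Swap n j d a → ¬ Swap n i d′ a
swap-opposite i∈ j∈ (opposites _ o) (raise p q) (raise p′ _) =
  proj₁ (middle-split i∈ j∈ o q) (p′ , p)
swap-opposite _ _ (opposites s _) (raise _ q) (lower _ _) =
  contradiction (half q s) (m+1+n≢n 1)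
swap-opposite _ _ (opposites s _) (raise _ q) (keep _ _) = contradiction (half q s) 1+n≢n
swap-opposite _ _ (opposites s _) (lower _ q) (raise _ q′) =
  contradiction (double-injective (trans q (sym q′))) 1+n≢n
swap-opposite _ _ (opposites s _) (lower _ q) (lower _ _) =
  contradiction (double-injective (trans s (sym q))) 1+n≢n
swap-opposite _ _ (opposites s _) (lower _ q) (keep _ _) = contradiction (trans s (sym q)) 1+n≢n
swap-opposite _ _ (opposites s _) (keep _ _) (raise {d} _ q) =
  contradiction (half q (trans (+-comm d (suc d)) s)) 1+n≢n
swap-opposite _ _ (opposites s _) (keep _ _) (lower {d} _ q) =
  contradiction (trans (sym (+-suc d d)) (trans s (sym q))) 1+n≢n
-- Both differences are now `a`, so `s` says that twice `a` is n, and whichever end lies above k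
-- should not have been kept.
swap-opposite i∈ j∈ (opposites s o) (keep p _) (keep p′ _) with middle-split i∈ j∈ o s
... | _ , inj₁ high = p′ high s
... | _ , inj₂ high = p high s

-- The colour as a relation between natural numbers, so that the combinatorics is free of integers,
-- rationals and permutations.
Coloured : (n i j a : ℕ) → Set
Coloured n i j a = ∃ λ d → Difference n i j d × Swap n j d a

coloured-functional : Coloured n i j a → Coloured n i j b → a ≡ b
coloured-functional (_ , δ , σ) (_ , δ′ , σ′) with refl ← difference-functional δ δ′ =
  swap-functional σ σ′

-- With j shared, undoing the exchange recovers the same difference on both sides. This serves both
-- proper prefixes and the count of a class.
coloured-injective : i ∈[1, n ] → i′ ∈[1, n ] →
  Coloured n i j a → Coloured n i′ j a → i ≡ i′
coloured-injective i∈ i′∈ (_ , δ , σ) (_ , δ′ , σ′)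
  with refl ← swap-functional (swap-sym σ) (swap-sym σ′) = difference-injective i∈ i′∈ δ δ′

coloured-opposite : i ∈[1, n ] → j ∈[1, n ] → Coloured n i j a → ¬ Coloured n j i a
coloured-opposite i∈ j∈ (_ , δ , σ) (_ , δ′ , σ′) =
  swap-opposite i∈ j∈ (difference-reverse δ δ′) σ σ′

-- Comparison with the integer- and rational-valued definitions

-- The wrapped branch of `f` is covered too, with n + i for i, since `pos n ℤ.+ pos i` computes to
-- `pos (n + i)`.
pos-difference : d + j ≡ i → pos i ℤ.- pos j ≡ pos d
pos-difference {d} {j} refl = begin
  pos (d + j) ℤ.- pos j  ≡⟨ ℤ.m-n≡m⊖n (d + j) j ⟩
  (d + j) ℤ.⊖ j          ≡⟨ ℤ.⊖-≥ (m≤n+m j d) ⟩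
  pos (d + j ∸ j)        ≡⟨ cong pos (m+n∸n≡m d j) ⟩
  pos d                  ∎
  where open ≡-Reasoning

-- The decision is an argument, so that matching on it reduces the conditional.
f-value : i ∈[1, n ] → j ∈[1, n ] → i ≢ j → (j<i? : Dec (j < i)) →
  ∃ λ d → Difference n i j d ×
    (if ⌊ j<i? ⌋ then pos i ℤ.- pos j else pos n ℤ.+ pos i ℤ.- pos j) ≡ pos d
f-value {i} {n} {j} _ _ i≢j (yes j<i) = i ∸ j , above j<i eq , pos-difference eq
  where
  eq : i ∸ j + j ≡ i
  eq = m∸n+n≡m (<⇒≤ j<i)
f-value {i} {n} {j} _ (_ , j≤n) i≢j (no j≮i) =
  n + i ∸ j , below (≤∧≢⇒< (≮⇒≥ j≮i) i≢j) eq , pos-difference eq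
  where
  eq : n + i ∸ j + j ≡ n + i
  eq = m∸n+n≡m (≤-trans j≤n (m≤m+n n i))

module _ {n : ℕ} where

  private
    k : ℚᵘ.ℚᵘ
    k = pos n / 2

    pos-*-2 : ∀ d → pos d ℤ.* pos 2 ≡ pos (d + d)
    pos-*-2 d = trans (sym (ℤ.pos-* d 2)) (cong pos (n*2≡n+n d))

    n*1 : pos n ℤ.* pos 1 ≡ pos n
    n*1 = ℤ.*-identityʳ (pos n)

    -- The left side is the unreduced numerator of n/2 + 1, cross-multiplied with the denominator 1.
    k+1 : (pos n ℤ.* pos 1 ℤ.+ pos 2) ℤ.* pos 1 ≡ pos (2 + n)
    k+1 = trans (ℤ.*-identityʳ _) (trans (cong (ℤ._+ pos 2) n*1) (cong pos (+-comm n 2)))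

  k<j⇒ : k ℚᵘ.< pos j / 1 → n < j + j
  k<j⇒ {j} p = ℤ.drop‿+<+ (subst₂ ℤ._<_ n*1 (pos-*-2 j) (ℚᵘ.drop-*<* p))

  k<j⇐ : n < j + j → k ℚᵘ.< pos j / 1
  k<j⇐ {j} p = ℚᵘ.*<* (subst₂ ℤ._<_ (sym n*1) (sym (pos-*-2 j)) (ℤ.+<+ p))

  d≃k⇒ : pos d / 1 ℚᵘ.≃ k → d + d ≡ n
  d≃k⇒ {d} p = ℤ.+-injective (subst₂ _≡_ (pos-*-2 d) n*1 (ℚᵘ.drop-*≡* p))

  d≃k⇐ : d + d ≡ n → pos d / 1 ℚᵘ.≃ k
  d≃k⇐ {d} p = ℚᵘ.*≡* (subst₂ _≡_ (sym (pos-*-2 d)) (sym n*1) (cong pos p))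

  d≃k+1⇒ : pos d / 1 ℚᵘ.≃ k ℚᵘ.+ 1ℚᵘ → d + d ≡ 2 + n
  d≃k+1⇒ {d} p = ℤ.+-injective (subst₂ _≡_ (pos-*-2 d) k+1 (ℚᵘ.drop-*≡* p))

  d≃k+1⇐ : d + d ≡ 2 + n → pos d / 1 ℚᵘ.≃ k ℚᵘ.+ 1ℚᵘ
  d≃k+1⇐ {d} p = ℚᵘ.*≡* (subst₂ _≡_ (sym (pos-*-2 d)) (sym k+1) (cong pos p))

  ε-value : ∀ {z} → z ≡ pos d →
    (up?   : Dec (k ℚᵘ.< pos j / 1 × z / 1 ℚᵘ.≃ k)) →
    (down? : Dec (k ℚᵘ.< pos j / 1 × z / 1 ℚᵘ.≃ k ℚᵘ.+ 1ℚᵘ)) →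
    ∃ λ a → Swap n j d a ×
      z ℤ.+ (if ⌊ up? ⌋ then 1ℤ else if ⌊ down? ⌋ then -1ℤ else 0ℤ) ≡ pos a
  ε-value {d} refl (yes (k<j , d≃k)) _ =
    suc d , raise (k<j⇒ k<j) (d≃k⇒ d≃k) , cong pos (+-comm d 1)
  -- Since k + 1 is positive, a zero difference is never lowered, and subtracting 1 stays within the
  -- naturals.
  ε-value {zero} refl (no _) (yes (_ , d≃k+1)) = contradiction (d≃k+1⇒ {0} d≃k+1) λ()
  ε-value {suc d} refl (no _) (yes (k<j , d≃k+1)) =
    d , lower (k<j⇒ k<j) (+-cancelˡ-≡ 2 _ _ (trans (sym (double-suc d)) (d≃k+1⇒ d≃k+1))) , refl
  ε-value {d} refl (no ¬up) (no ¬down) =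
    d , keep (λ k<j d≡k → ¬up (k<j⇐ k<j , d≃k⇐ d≡k))
             (λ k<j d≡k+1 → ¬down (k<j⇐ k<j , d≃k+1⇐ d≡k+1))
      , ℤ.+-identityʳ (pos d)

coloured-surjective : 3 ≤ n → j ∈[1, n ] → 1 ≤ a → a < n →
  ∃ λ i → i ∈[1, n ] × Coloured n i j a
coloured-surjective {n} {j} {a} 3≤n j∈ 1≤a a<n =
  -- The exchange is applied to the wanted colour `a` itself; being an involution, it sends the
  -- resulting `d` back to `a`.
  let d , σ , _ = ε-value {j = j} refl
        ((pos n / 2 ℚᵘ.<? pos j / 1) ×-dec (pos a / 1 ℚᵘ.≃? pos n / 2))
        ((pos n / 2 ℚᵘ.<? pos j / 1) ×-dec (pos a / 1 ℚᵘ.≃? pos n / 2 ℚᵘ.+ 1ℚᵘ))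
      1≤d , d<n = swap-range 3≤n σ (1≤a , a<n)
      i , i∈ , δ = difference-surjective 1≤d d<n j∈
  in i , i∈ , d , δ , swap-sym σ

-- The colour of a permutation in terms of its end entries

permutation-injective : ∀ (π : Permutation′ n) {x y} → π ⟨$⟩ʳ x ≡ π ⟨$⟩ʳ y → x ≡ y
permutation-injective π = Injection.injective (↔⇒↣ π)

entry∈ : ∀ (π : Permutation′ n) p → entry π p ∈[1, n ]
entry∈ π p = s≤s z≤n , Fin.toℕ<n (π ⟨$⟩ʳ p)

module _ {m : ℕ} where

  private
    n₂ : ℕ
    n₂ = suc (suc m)

  first≢last : ∀ (π : Permutation′ n₂) → firstEntry π ≢ lastEntry π
  first≢last π eq = contradiction
    (permutation-injective π (Fin.toℕ-injective (suc-injective eq))) λ()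

  c-value : ∀ (π : Permutation′ n₂) → ∃₂ λ d a →
    Difference n₂ (firstEntry π) (lastEntry π) d × Swap n₂ (lastEntry π) d a ×
    f π ≡ pos d × c π ≡ pos a
  c-value π =
    let i = firstEntry π
        j = lastEntry π
        d , δ , f≡d = f-value (entry∈ π firstPos) (entry∈ π lastPos) (first≢last π) (j <? i)
        a , σ , c≡a = ε-value {j = j} f≡d
          -- These are the very decisions in the definition of `ε`, so the conditional obtained is
          -- `ε π`.
          ((pos n₂ / 2 ℚᵘ.<? pos j / 1) ×-dec (f π / 1 ℚᵘ.≃? pos n₂ / 2))
          ((pos n₂ / 2 ℚᵘ.<? pos j / 1) ×-dec (f π / 1 ℚᵘ.≃? pos n₂ / 2 ℚᵘ.+ 1ℚᵘ))
    in d , a , δ , σ , f≡d , c≡a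

  c-coloured : ∀ (π : Permutation′ n₂) → c π ≡ pos a → Coloured n₂ (firstEntry π) (lastEntry π) a
  c-coloured π c≡a with d , b , δ , σ , _ , c≡b ← c-value π
    with refl ← ℤ.+-injective (trans (sym c≡a) c≡b) = d , δ , σ

  coloured-c : ∀ (π : Permutation′ n₂) → Coloured n₂ (firstEntry π) (lastEntry π) a → c π ≡ pos a
  coloured-c π col with d , b , δ , σ , _ , c≡b ← c-value π =
    trans c≡b (cong pos (coloured-functional (d , δ , σ) col))

  -- For odd n nothing is exchanged, so f + ε = f, and f cancels.
  ε-odd : ¬ 2 ∣ n₂ → ∀ (π : Permutation′ n₂) → ε π ≡ 0ℤ
  ε-odd odd π with d , a , _ , σ , f≡d , c≡a ← c-value π = identityʳ-unique (f π) (ε π)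
    (trans c≡a (trans (cong pos (sym (swap-odd odd σ))) (sym f≡d)))

  c-cong : ∀ {π ρ : Permutation′ n₂} → π Perm.≈ ρ → c π ≡ c ρ
  c-cong {π} {ρ} π≈ρ with d , a , δ , σ , _ , c≡a ← c-value π = trans c≡a (sym (coloured-c ρ
    (subst₂ (λ x y → Coloured n₂ (suc (toℕ x)) (suc (toℕ y)) a)
      (π≈ρ zero) (π≈ρ (fromℕ (suc m))) (d , δ , σ))))

  c-range : 3 ≤ n₂ → ∀ (π : Permutation′ n₂) → Color n₂ (c π)
  c-range 3≤n π with d , a , δ , σ , _ , c≡a ← c-value π
    with 1≤a , a<n ← swap-range 3≤n σ
           (difference-range (entry∈ π firstPos) (entry∈ π lastPos) δ)
    rewrite c≡a = ℤ.+≤+ 1≤a , ℤ.+≤+ (s≤s⁻¹ a<n)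

-- Prefix reversals

reverseFirst-< : ∀ k .(k≤n : k ≤ n) (x : Fin n) → toℕ x < k →
  toℕ (reverseFirst k k≤n x) ≡ k ∸ suc (toℕ x)
reverseFirst-< {n} k k≤n x x<k = lemma (toℕ x <? k)
  where
  open ≡-Reasoning
  lemma : ∀ x<k? → toℕ (reverseAt k≤n x x<k?) ≡ k ∸ suc (toℕ x)
  lemma (no  x≮k) = contradiction x<k x≮k
  lemma (yes x<k) = begin
    toℕ (inject≤ (opposite (fromℕ< x<k)) k≤n)  ≡⟨ Fin.toℕ-inject≤ _ k≤n ⟩
    toℕ (opposite (fromℕ< x<k))                ≡⟨ Fin.opposite-prop (fromℕ< x<k) ⟩
    k ∸ suc (toℕ (fromℕ< x<k))                 ≡⟨ cong (λ y → k ∸ suc y) (Fin.toℕ-fromℕ< x<k) ⟩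
    k ∸ suc (toℕ x)                            ∎

reverseFirst-≮ : ∀ k .(k≤n : k ≤ n) (x : Fin n) → ¬ toℕ x < k → reverseFirst k k≤n x ≡ x
reverseFirst-≮ {n} k k≤n x x≮k = lemma (toℕ x <? k)
  where
  lemma : ∀ x<k? → reverseAt k≤n x x<k? ≡ x
  lemma (no  _)   = refl
  lemma (yes x<k) = contradiction x<k x≮k

-- All that the colouring can see of a prefix reversal: the full one exchanges the ends, a proper
-- one moves only the first.
data MovesEnds {m : ℕ} (ρ : Permutation′ (suc m)) : Set where
  exchanges : ρ ⟨$⟩ʳ zero ≡ fromℕ m → ρ ⟨$⟩ʳ fromℕ m ≡ zero → MovesEnds ρ
  fixesLast : ρ ⟨$⟩ʳ zero ≢ zero → ρ ⟨$⟩ʳ fromℕ m ≡ fromℕ m → MovesEnds ρ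

prefixReversal-movesEnds : ∀ {m} {ρ : Permutation′ (suc m)} → IsPrefixReversal ρ → MovesEnds ρ
-- The prefix has length 2 + k and there are m + 1 positions, so the reversal is full exactly when
-- `suc k` is `m`.
prefixReversal-movesEnds {m} {ρ} (suc (suc k) , s≤s (s≤s _) , s≤s 1+k≤m , ρ≈) with suc k ≟ m
... | yes refl = exchanges
  (Fin.toℕ-injective (begin
    toℕ (ρ ⟨$⟩ʳ zero)                              ≡⟨ cong toℕ (ρ≈ zero) ⟩
    toℕ (reverseFirst (suc m) ≤-refl (zero {m}))   ≡⟨ reverseFirst-< (suc m) ≤-refl (zero {m}) (s≤s z≤n) ⟩
    m                                              ≡⟨ Fin.toℕ-fromℕ m ⟨
    toℕ (fromℕ m)                                  ∎))
  (Fin.toℕ-injective (begin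
    toℕ (ρ ⟨$⟩ʳ fromℕ m)                          ≡⟨ cong toℕ (ρ≈ (fromℕ m)) ⟩
    toℕ (reverseFirst (suc m) ≤-refl (fromℕ m))   ≡⟨ reverseFirst-< (suc m) ≤-refl (fromℕ m) (Fin.toℕ<n (fromℕ m)) ⟩
    m ∸ toℕ (fromℕ m)                             ≡⟨ cong (m ∸_) (Fin.toℕ-fromℕ m) ⟩
    m ∸ m                                         ≡⟨ n∸n≡0 m ⟩
    0                                             ∎))
  where open ≡-Reasoning
... | no 1+k≢m = fixesLast
  -- Position 0 goes to position `suc k`.
  (λ ρ0≡0 → 1+n≢0 (trans (sym (reverseFirst-< (2 + k) (s≤s 1+k≤m) (zero {m}) (s≤s z≤n)))
    (cong toℕ (trans (sym (ρ≈ zero)) ρ0≡0))))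
  (trans (ρ≈ (fromℕ m)) (reverseFirst-≮ (2 + k) (s≤s 1+k≤m) (fromℕ m)
    (≤⇒≯ (subst (2 + k ≤_) (sym (Fin.toℕ-fromℕ m)) (≤∧≢⇒< 1+k≤m 1+k≢m)))))

-- Properness

module _ {m : ℕ} where

  private
    n₂ : ℕ
    n₂ = suc (suc m)

  c-proper : ∀ {π σ : Permutation′ n₂} → Graph._~_ (Pancake n₂) π σ → c π ≢ c σ
  c-proper {π} {σ} (ρ , rev , σ≈πρ) cπ≡cσ with c-value π
  ... | d , a , _ , _ , _ , cπ≡a
    with c-coloured π cπ≡a | c-coloured σ (trans (sym cπ≡cσ) cπ≡a) | prefixReversal-movesEnds {ρ = ρ} rev
  ... | colπ | colσ | exchanges ρ0 ρlast = coloured-opposite (entry∈ π firstPos) (entry∈ π lastPos) colπ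
    (subst₂ (λ x y → Coloured n₂ (suc (toℕ x)) (suc (toℕ y)) a)
      (trans (σ≈πρ zero) (cong (π ⟨$⟩ʳ_) ρ0))
      (trans (σ≈πρ (fromℕ (suc m))) (cong (π ⟨$⟩ʳ_) ρlast)) colσ)
  -- Equal colours and equal last entries give equal first entries, so `ρ` would fix position 0.
  ... | colπ | colσ | fixesLast ρ0≢0 ρlast = ρ0≢0 (permutation-injective π
    (trans (sym (σ≈πρ zero)) (Fin.toℕ-injective (suc-injective (coloured-injective
      (entry∈ σ firstPos) (entry∈ π firstPos)
      (subst (λ y → Coloured n₂ (firstEntry σ) (suc (toℕ y)) a)
        (trans (σ≈πρ (fromℕ (suc m))) (cong (π ⟨$⟩ʳ_) ρlast)) colσ)
      colπ)))))

  c-isProperColoring : 3 ≤ n₂ → IsProperColoring (Pancake n₂) (Color n₂) c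
  c-isProperColoring 3≤n = record
    { respects = λ {π} {ρ} → c-cong {π = π} {ρ}
    ; inRange  = c-range 3≤n
    ; proper   = λ {π} {σ} → c-proper {π} {σ}
    }

-- Counting

insert-self : ∀ {m n} i j (π : Permutation m n) → insert i j π ⟨$⟩ʳ i ≡ j
insert-self i j π with i Fin.≟ i
... | yes _  = refl
... | no i≢i = contradiction refl i≢i

insert-cong : ∀ {m n} i j (π ρ : Permutation m n) → π Perm.≈ ρ → insert i j π Perm.≈ insert i j ρ
insert-cong i j π ρ π≈ρ k with i Fin.≟ k
... | yes _ = refl
... | no  _ = cong (punchIn j) (π≈ρ _)

-- `remove` relabels the values around the removed one; punching that value back in makes the two
-- sides comparable.
remove-cong : ∀ {m n} i (π ρ : Permutation (suc m) (suc n)) → π Perm.≈ ρ → remove i π Perm.≈ remove i ρ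
remove-cong i π ρ π≈ρ k = Fin.punchIn-injective (ρ ⟨$⟩ʳ i) _ _ (begin
  punchIn (ρ ⟨$⟩ʳ i) (remove i π ⟨$⟩ʳ k)  ≡⟨ cong (λ x → punchIn x (remove i π ⟨$⟩ʳ k)) (π≈ρ i) ⟨
  punchIn (π ⟨$⟩ʳ i) (remove i π ⟨$⟩ʳ k)  ≡⟨ punchIn-permute π i k ⟨
  π ⟨$⟩ʳ punchIn i k                      ≡⟨ π≈ρ (punchIn i k) ⟩
  ρ ⟨$⟩ʳ punchIn i k                      ≡⟨ punchIn-permute ρ i k ⟩
  punchIn (ρ ⟨$⟩ʳ i) (remove i ρ ⟨$⟩ʳ k)  ∎)
  where open ≡-Reasoning

SymSetoid : ℕ → Setoid 0ℓ 0ℓ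
SymSetoid n = Group.setoid (Sym n)

-- A permutation amounts to its value at `p` and the induced bijection of the rest; this is the
-- recursion of the factorial.
insertInverse : ∀ {n} → Fin (suc n) →
  Inverse (setoid (Fin (suc n)) ×ₛ SymSetoid n) (SymSetoid (suc n))
insertInverse {n} p = record
  { to        = λ (j , ρ) → insert p j ρ
  ; from      = from
  ; to-cong   = λ {(j , ρ)} {(_ , ρ′)} → λ { (refl , ρ≈ρ′) → insert-cong p j ρ ρ′ ρ≈ρ′ }
  ; from-cong = λ {π} {ρ} → from-cong π ρ
  ; inverse   = (λ {π} {(_ , ρ)} → λ { (refl , ρ≈) k →
                  trans (insert-cong p _ ρ (remove p π) ρ≈ k) (insert-remove p π k) })
              , λ {(j , ρ)} {π} π≈ →
                  let eq , rest = from-cong π (insert p j ρ) π≈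
                  in trans eq (insert-self p j ρ) , λ k → trans (rest k) (remove-insert p j ρ k)
  }
  where
  open Setoid (setoid (Fin (suc n)) ×ₛ SymSetoid n) using () renaming (Carrier to A; _≈_ to _≈ₐ_)

  from : Permutation′ (suc n) → A
  from π = (π ⟨$⟩ʳ p) , remove p π

  from-cong : ∀ π ρ → π Perm.≈ ρ → from π ≈ₐ from ρ
  from-cong π ρ π≈ρ = π≈ρ p , remove-cong p π ρ π≈ρ

*-hasSize : ∀ {m n} {S : Setoid 0ℓ 0ℓ} → HasSize S n → HasSize (setoid (Fin m) ×ₛ S) (m * n)
*-hasSize {m} S-size = Composition.inverse
  (Composition.inverse Fin.*↔× (Symmetry.inverse Pointwise-≡↔≡))
  (Identity.inverse (setoid (Fin m)) ×-inverse S-size)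

Sym-hasSize : ∀ n → HasSize (SymSetoid n) (n !)
Sym-hasSize zero = record
  { to        = λ _ → Perm.id
  ; from      = λ _ → zero
  ; to-cong   = λ _ ()
  ; from-cong = λ _ → refl
  ; inverse   = (λ _ ()) , λ { {zero} _ → refl }
  }
Sym-hasSize (suc n) = Composition.inverse (*-hasSize (Sym-hasSize n)) (insertInverse zero)

-- Sizes of the colour classes

module _ {m : ℕ} where

  private
    n₂ : ℕ
    n₂ = suc (suc m)

    last : Fin n₂
    last = fromℕ (suc m)

  -- The first entry is given among the values other than `j`, the form in which it is inserted
  -- before `j` is.
  unique-first : 3 ≤ n₂ → 1 ≤ a → a < n₂ → ∀ (j : Fin n₂) →
    ∃ λ (i : Fin (suc m)) → Coloured n₂ (suc (toℕ (punchIn j i))) (suc (toℕ j)) a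
  unique-first {a} 3≤n 1≤a a<n j
    with coloured-surjective 3≤n (s≤s z≤n , Fin.toℕ<n j) 1≤a a<n
  ... | suc i , (_ , i<n) , col =
    punchOut j≢i , subst (λ x → Coloured n₂ (suc x) (suc (toℕ j)) a) (sym eq) col
    where
    j≢i : j ≢ fromℕ< i<n
    j≢i refl = difference-irrefl (proj₁ (proj₂ col)) (cong suc (sym (Fin.toℕ-fromℕ< i<n)))

    eq : toℕ (punchIn j (punchOut j≢i)) ≡ i
    eq = trans (cong toℕ (Fin.punchIn-punchOut j≢i)) (Fin.toℕ-fromℕ< i<n)

  module _ (3≤n : 3 ≤ n₂) (1≤a : 1 ≤ a) (a<n : a < n₂) where

    private
      Class : Setoid 0ℓ 0ℓ
      Class = ColorClass (Pancake n₂) c (pos a)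

      open Setoid Class using () renaming (Carrier to C; _≈_ to _≈ᶜ_)
      open Setoid (setoid (Fin n₂) ×ₛ SymSetoid m) using () renaming (Carrier to A; _≈_ to _≈ₐ_)

      first : Fin n₂ → Fin (suc m)
      first j = proj₁ (unique-first 3≤n 1≤a a<n j)

      perm : Fin n₂ → Permutation′ m → Permutation′ n₂
      perm j ρ = insert last j (insert zero (first j) ρ)

      perm-last : ∀ j ρ → perm j ρ ⟨$⟩ʳ last ≡ j
      perm-last j ρ = insert-self last j (insert zero (first j) ρ)

      perm-first : ∀ j ρ → perm j ρ ⟨$⟩ʳ zero ≡ punchIn j (first j)
      -- Inserting at the last position leaves position zero in place: `punchIn last zero` computes
      -- to `zero`.
      perm-first j ρ = trans (insert-punchIn last j (insert zero (first j) ρ) zero)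
        (cong (punchIn j) (insert-self zero (first j) ρ))

      to : A → C
      to (j , ρ) = perm j ρ , coloured-c (perm j ρ)
        (subst₂ (λ x y → Coloured n₂ (suc (toℕ x)) (suc (toℕ y)) a)
          (sym (perm-first j ρ)) (sym (perm-last j ρ)) (proj₂ (unique-first 3≤n 1≤a a<n j)))

      from : C → A
      from (π , _) = (π ⟨$⟩ʳ last) , remove zero (remove last π)

      from-cong : ∀ (x y : C) → proj₁ x Perm.≈ proj₁ y → from x ≈ₐ from y
      from-cong (π , _) (ρ , _) π≈ρ = π≈ρ last ,
        remove-cong zero (remove last π) (remove last ρ) (remove-cong last π ρ π≈ρ)

      -- `from` discards the first entry. The colour restores it: the chosen entry and the actual
      -- one yield the same colour with the same last entry.
      first-remove : ∀ ((π , _) : C) → first (π ⟨$⟩ʳ last) ≡ remove last π ⟨$⟩ʳ zero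
      first-remove (π , c≡a) = Fin.punchIn-injective ℓ _ _ (Fin.toℕ-injective (suc-injective
        (coloured-injective
          (s≤s z≤n , Fin.toℕ<n (punchIn ℓ (first ℓ))) (s≤s z≤n , Fin.toℕ<n (punchIn ℓ _))
          (proj₂ (unique-first 3≤n 1≤a a<n ℓ))
          (subst (λ x → Coloured n₂ (suc (toℕ x)) (suc (toℕ ℓ)) a)
            (punchIn-permute π last zero) (c-coloured π c≡a)))))
        where
        ℓ : Fin n₂
        ℓ = π ⟨$⟩ʳ last

    class-inverse : Inverse (setoid (Fin n₂) ×ₛ SymSetoid m) Class
    class-inverse = record
      { to        = to
      ; from      = from
      ; to-cong   = λ {(j , ρ)} {(_ , ρ′)} → λ { (refl , ρ≈ρ′) → to-cong j ρ ρ′ ρ≈ρ′ }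
      ; from-cong = λ {x} {y} → from-cong x y
      ; inverse   = (λ {x} {(j , ρ)} → λ { (refl , ρ≈) k →
                      trans (to-cong j ρ _ ρ≈ k) (to-from x k) })
                  , λ {(j , ρ)} {x} x≈ → let eq , rest = from-cong x (to (j , ρ)) x≈
                                             eq′ , rest′ = from-to j ρ
                                         in trans eq eq′ , λ k → trans (rest k) (rest′ k)
      }
      where
      to-cong : ∀ j ρ ρ′ → ρ Perm.≈ ρ′ → perm j ρ Perm.≈ perm j ρ′
      to-cong j ρ ρ′ ρ≈ρ′ = insert-cong last j (insert zero (first j) ρ) (insert zero (first j) ρ′)
        (insert-cong zero (first j) ρ ρ′ ρ≈ρ′)

      to-from : ∀ (x : C) → proj₁ (to (from x)) Perm.≈ proj₁ x
      to-from x@(π , _) k = trans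
        (insert-cong last (π ⟨$⟩ʳ last) (insert zero (first (π ⟨$⟩ʳ last)) π″) π′ inner k)
        (insert-remove last π k)
        where
        π′ : Permutation′ (suc m)
        π′ = remove last π

        π″ : Permutation′ m
        π″ = remove zero π′

        inner : insert zero (first (π ⟨$⟩ʳ last)) π″ Perm.≈ π′
        inner l = trans (cong (λ i → insert zero i π″ ⟨$⟩ʳ l) (first-remove x))
          (insert-remove zero π′ l)

      from-to : ∀ j ρ → from (to (j , ρ)) ≈ₐ (j , ρ)
      from-to j ρ = perm-last j ρ , λ k → trans
        (remove-cong zero (remove last (perm j ρ)) (insert zero (first j) ρ)
          (remove-insert last j (insert zero (first j) ρ)) k)
        (remove-insert zero (first j) ρ k)

    class-hasSize : HasSize Class (n₂ * m !)
    class-hasSize = Composition.inverse (*-hasSize (Sym-hasSize m)) class-inverse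

  colorClass-hasSize : 3 ≤ n₂ → ∀ a → Color n₂ a → HasSize (ColorClass (Pancake n₂) c a) (n₂ * m !)
  colorClass-hasSize 3≤n (pos a) (ℤ.+≤+ 1≤a , ℤ.+≤+ a≤1+m) = class-hasSize 3≤n 1≤a (s≤s a≤1+m)

theorem3 : (n : ℕ) .{{_ : NonZero n}} → n ≥ 3 →
    (∀ π → firstEntry {n} π ≢ lastEntry π)
    × (¬ 2 ∣ n → ∀ π → ε {n} π ≡ 0ℤ)
    × IsProperColoring (Pancake n) (Color n) c
    × IsEquitable (Pancake n) (Color n) c
    × (∀ a → Color n a → HasSize (ColorClass (Pancake n) c a) (n * (n ∸ 2) !))
theorem3 (suc (suc m)) n≥3 =
    first≢last
  , ε-odd
  , c-isProperColoring n≥3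
  -- All classes have the same size, so the distance is 0.
  , (λ {a} {b} a∈ b∈ → _ , _ , colorClass-hasSize n≥3 a a∈ , colorClass-hasSize n≥3 b b∈ ,
      ≤-trans (≤-reflexive (∣n-n∣≡0 (suc (suc m) * m !))) z≤n)
  , colorClass-hasSize n≥3
theorem3 (suc zero) (s≤s ())
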